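{- For every integer $q \geq 3$, the competition number of the Hamming graph $H(3,q)$ is $k(H(3,q)) = 6$.
   Context: For a positive integer $q$, let $[q]=\{1,2,\ldots,q\}$, and let $[q]^n$ be the set of $n$-tuples over $[q]$. For positive integers $n,q$, the Hamming graph $H(n,q)$ has vertex set $[q]^n$, and two vertices $x=(x_1,\ldots,x_n)$, $y=(y_1,\ldots,y_n)$ are adjacent if and only if $|\{i\in[n] \mid x_i\neq y_i\}|=1$. All graphs and digraphs are finite. The competition graph $C(D)$ of a digraph $D$ is the simple undirected graph with the same vertex set as $D$ in which two distinct vertices $u$ and $v$ are adjacent if and only if there is a vertex $x$ of $D$ such that both $(u,x)$ and $(v,x)$ are arcs of $D$. The competition number $k(G)$ of a graph $G$ is the smallest integer $k\geq 0$ such that $G$ together with $k$ additional isolated vertices is the competition graph of an acyclic digraph (a digraph with no directed cycles). -}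

module Defs where

open import Data.Fin using (Fin; zero)
import Data.Fin.Properties as Fin
open import Data.Nat using (ℕ; zero; suc; _+_; _^_; _≤_)
import Data.Nat.Properties as ℕ
open import Data.Empty using (⊥)
open import Data.Product using (Σ; ∃; _×_; _,_; uncurry)
open import Data.Product.Function.NonDependent.Propositional using (_×-↔_)
open import Data.Sum using (_⊎_)
open import Data.Sum.Function.Propositional using (_⊎-↔_)
open import Data.Sum.Relation.Binary.Pointwise using (Pointwise; ⊎-symmetric; ⊎-decidable)
import Data.Sum.Relation.Binary.Pointwise as Sum
open import Data.Vec using (Vec; []; _∷_; lookup; count; allFin)
open import Function using (_∘_; const)
open import Function.Bundles using (_↔_; _⇔_; mk↔ₛ′; module Inverse)
open import Function.Properties.Inverse using (↔-refl; ↔-sym; ↔-trans; ↔⇒↣)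
open import Level using (0ℓ)
open import Relation.Binary.Construct.Closure.Transitive using (TransClosure)
open import Relation.Binary.Core using (Rel)
open import Relation.Binary.Definitions
  using (Decidable; DecidableEquality; Symmetric; Irreflexive)
open import Relation.Binary.PropositionalEquality
  using (_≡_; _≢_; refl; sym; trans; cong; subst; ≢-sym)
open import Relation.Nullary using (¬_; Dec; yes; no; ¬?)
open import Relation.Nullary.Decidable using (_×-dec_; map′; via-injection)
import Relation.Unary as U

record FiniteSet : Set₁ where
  field
    Carrier     : Set
    size        : ℕ
    enumeration : Carrier ↔ Fin size

  _≟_ : DecidableEquality Carrier
  _≟_ = via-injection (↔⇒↣ enumeration) Fin._≟_

  any? : {P : U.Pred Carrier 0ℓ} → U.Decidable P → Dec (∃ P)
  any? {P} P? = map′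
    (λ (i , p) → from i , p)
    (λ (x , p) → to x , subst P (sym (strictlyInverseʳ x)) p)
    (Fin.any? (P? ∘ from))
    where open Inverse enumeration

open FiniteSet using (Carrier)

finSet : ℕ → FiniteSet
finSet n = record { Carrier = Fin n ; size = n ; enumeration = ↔-refl }

infixr 1 _⊎ᶠ_
_⊎ᶠ_ : FiniteSet → FiniteSet → FiniteSet
A ⊎ᶠ B = record
  { Carrier     = A.Carrier ⊎ B.Carrier
  ; size        = A.size + B.size
  ; enumeration = ↔-trans (A.enumeration ⊎-↔ B.enumeration) (↔-sym Fin.+↔⊎)
  }
  where
  module A = FiniteSet A
  module B = FiniteSet B

Vec↔Fin : ∀ q n → Vec (Fin q) n ↔ Fin (q ^ n)
Vec↔Fin q zero    = mk↔ₛ′ (const zero) (const []) (λ { zero → refl }) (λ { [] → refl })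
Vec↔Fin q (suc n) = ↔-trans uncons (↔-trans (↔-refl ×-↔ Vec↔Fin q n) (↔-sym Fin.*↔×))
  where
  uncons : Vec (Fin q) (suc n) ↔ (Fin q × Vec (Fin q) n)
  uncons = mk↔ₛ′ (λ { (x ∷ xs) → x , xs }) (uncurry _∷_)
                 (λ _ → refl) (λ { (_ ∷ _) → refl })

-- [q]ⁿ, with Fin q in the role of [q] = {1, …, q}.
tuples : ℕ → ℕ → FiniteSet
tuples n q = record
  { Carrier = Vec (Fin q) n ; size = q ^ n ; enumeration = Vec↔Fin q n }

-- Adjacency and arcs are decidable: on a finite vertex set this is automatic
-- classically, and constructively it is what makes the edge set finite.
record Graph (V : FiniteSet) : Set₁ where
  field
    Adj     : Rel (Carrier V) 0ℓ
    adj?    : Decidable Adj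
    symm    : Symmetric Adj
    irrefl  : Irreflexive _≡_ Adj

record Digraph (V : FiniteSet) : Set₁ where
  field
    Arc  : Rel (Carrier V) 0ℓ
    arc? : Decidable Arc

infix 4 _≈_
_≈_ : ∀ {V} → Graph V → Graph V → Set
G ≈ H = ∀ u v → Graph.Adj G u v ⇔ Graph.Adj H u v

-- A directed cycle, loops included, exists exactly when some vertex is
-- reachable from itself by a walk of positive length.
Acyclic : ∀ {V} → Digraph V → Set
Acyclic D = ∀ x → ¬ TransClosure (Digraph.Arc D) x x

competitionGraph : ∀ {V} → Digraph V → Graph V
competitionGraph {V} D = record
  { Adj    = λ u v → u ≢ v × ∃ λ x → Arc u x × Arc v x
  ; adj?   = λ u v → ¬? (u ≟ v) ×-dec any? (λ x → arc? u x ×-dec arc? v x)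
  ; symm   = λ (u≢v , x , ux , vx) → ≢-sym u≢v , x , vx , ux
  ; irrefl = λ u≡v (u≢v , _) → u≢v u≡v
  }
  where
  open FiniteSet V using (_≟_; any?)
  open Digraph D

infixl 6 _∪I_
_∪I_ : ∀ {V} → Graph V → (k : ℕ) → Graph (V ⊎ᶠ finSet k)
G ∪I k = record
  { Adj    = Pointwise Adj (λ _ _ → ⊥)
  ; adj?   = ⊎-decidable adj? (λ _ _ → no λ ())
  ; symm   = ⊎-symmetric symm (λ ())
  ; irrefl = λ { refl (Sum.inj₁ a) → irrefl refl a }
  }
  where open Graph G

IsCompetitionGraphOfAcyclic : ∀ {V} → Graph V → Set₁
IsCompetitionGraphOfAcyclic {V} G =
  Σ (Digraph V) λ D → Acyclic D × competitionGraph D ≈ G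

-- k(G) = k, as a relation: the existence of k(G) (Roberts) is not needed to
-- state its value.
IsCompetitionNumber : ∀ {V} → Graph V → ℕ → Set₁
IsCompetitionNumber G k =
  IsCompetitionGraphOfAcyclic (G ∪I k) ×
  (∀ j → IsCompetitionGraphOfAcyclic (G ∪I j) → k ≤ j)

hammingDistance : ∀ {n q} → Vec (Fin q) n → Vec (Fin q) n → ℕ
hammingDistance {n} x y = count (λ i → ¬? (lookup x i Fin.≟ lookup y i)) (allFin n)

private
  count-sym : ∀ {n q m} (x y : Vec (Fin q) n) (is : Vec (Fin n) m) →
              count (λ i → ¬? (lookup x i Fin.≟ lookup y i)) is ≡
              count (λ i → ¬? (lookup y i Fin.≟ lookup x i)) is
  count-sym x y []       = refl
  count-sym x y (i ∷ is)
    with lookup x i Fin.≟ lookup y i | lookup y i Fin.≟ lookup x i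
  ... | yes _ | yes _ = count-sym x y is
  ... | no _  | no _  = cong suc (count-sym x y is)
  ... | yes p | no ¬q with () ← ¬q (sym p)
  ... | no ¬p | yes q with () ← ¬p (sym q)

  count-refl : ∀ {n q m} (x : Vec (Fin q) n) (is : Vec (Fin n) m) →
               count (λ i → ¬? (lookup x i Fin.≟ lookup x i)) is ≡ 0
  count-refl x []       = refl
  count-refl x (i ∷ is) with lookup x i Fin.≟ lookup x i
  ... | yes _ = count-refl x is
  ... | no ¬p with () ← ¬p refl

hammingDistance-sym : ∀ {n q} (x y : Vec (Fin q) n) →
                      hammingDistance x y ≡ hammingDistance y x
hammingDistance-sym x y = count-sym x y (allFin _)

hammingDistance-refl : ∀ {n q} (x : Vec (Fin q) n) → hammingDistance x x ≡ 0
hammingDistance-refl x = count-refl x (allFin _)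

H : (n q : ℕ) → Graph (tuples n q)
H n q = record
  { Adj    = λ x y → hammingDistance x y ≡ 1
  ; adj?   = λ x y → hammingDistance x y ℕ.≟ 1
  ; symm   = λ {x} {y} d≡1 → trans (hammingDistance-sym y x) d≡1
  ; irrefl = λ { {x} refl d≡1 → ℕ.0≢1+n (trans (sym (hammingDistance-refl x)) d≡1) }
  }

{-# OPTIONS --safe #-}
module Submission where

-- A prey shared by two vertices of H(3,q) singles out the line (maximal clique)
-- containing all its predators, so every line needs a prey of its own.
--
-- Lower bound: choose w₁, …, w₅ successively so that every vertex hunted by wᵢ is
-- an extra vertex or one of w₁, …, wᵢ₋₁.  Five vertices meet at least ten lines, and
-- these have preys among the k extra vertices and w₁, …, w₄, whence 10 ≤ k + 4.
-- The lines meeting a set S are counted by its three coordinate shadows.  Cut S into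
-- layers of constant first coordinate: the shadow along that coordinate is at least
-- as large as each layer, and the other two shadows of a layer of s points have
-- sizes a, b with s ≤ a b, and are disjoint for different layers.
--
-- Upper bound: list preys before their predators, and fill a growing box slab by
-- slab, from {0} × [2] × [2] to [q] × [2] × [2], then [q] × [q] × [2], then [q]³.
-- With six extra vertices, each line met for the first time finds an unused vertex
-- listed before all its points.

open import Defs
open import Algebra.Properties.CommutativeSemigroup using (interchange)
open import Data.Bool using (true; false)
open import Data.Empty using (⊥)
open import Data.Fin using (Fin; zero; suc; toℕ; fromℕ; inject₁; combine; join; splitAt)
open import Data.Fin.Induction using (spo-noetherian; Acc; acc)
open import Data.Fin.Patterns
import Data.Fin.Properties as Fin
open import Data.Fin.Relation.Unary.Top using (view; view-fromℕ; view-inject₁; ‵fromℕ; ‵inject₁)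
open import Data.List using (List; []; _∷_; _++_; length; map; filter; deduplicate; lookup)
import Data.List.Membership.DecPropositional as DecMembership
open import Data.List.Membership.Propositional using (_∈_; _∉_)
open import Data.List.Membership.Propositional.Properties
import Data.List.Membership.Setoid.Properties as Setoid
open import Data.List.Properties using (length-++; length-map; length-filter; filter-reject)
open import Data.List.Relation.Binary.Subset.Propositional using (_⊆_)
import Data.List.Relation.Unary.All as All
open import Data.List.Relation.Unary.All.Properties using (¬Any⇒All¬)
open import Data.List.Relation.Unary.AllPairs using ([]; _∷_)
open import Data.List.Relation.Unary.Any using (here; there; index)
import Data.List.Relation.Unary.Unique.DecPropositional.Properties as DecUnique
open import Data.List.Relation.Unary.Unique.Propositional using (Unique)
import Data.List.Relation.Unary.Unique.Propositional.Properties as Unique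
open import Data.Maybe using (Maybe; just; nothing; maybe′)
open import Data.Nat using (ℕ; zero; suc; _+_; _*_; _^_; _/_; _%_; _≤_; _<_; _≤?_; _<?_; z≤n; s≤s; s≤s⁻¹; z<s; s<s)
open import Data.Nat.Properties hiding (_≟_)
open import Data.Product using (∃; ∃₂; _×_; _,_; proj₁; proj₂)
open import Data.Sum using (_⊎_; inj₁; inj₂; [_,_]′)
open import Data.Sum.Properties using (inj₁-injective; inj₂-injective) renaming (≡-dec to ⊎-≡-dec)
import Data.Sum.Relation.Binary.Pointwise as Sum
open import Data.Vec as Vec using (Vec; []; _∷_; head; removeAt; insertAt)
open import Data.Vec.Properties using (≡-dec; insertAt-lookup; insertAt-removeAt; removeAt-insertAt; removeAt-punchOut)
open import Data.Vec.Relation.Binary.Lex.Strict as Lex using (Lex-<; this; next)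
open import Function using (_∘_)
open import Function.Bundles using (mk⇔; module Inverse; module Equivalence)
open import Level using (0ℓ)
import Relation.Binary as B
open import Relation.Binary.Construct.Closure.Transitive using (TransClosure; [_]; _∷_; transitive)
open import Relation.Binary.Core using (Rel)
open import Relation.Binary.PropositionalEquality
open import Relation.Binary.PropositionalEquality.Properties using (setoid)
open import Relation.Nullary using (¬_; ¬?; yes; no; contradiction; does)
open import Relation.Nullary.Decidable using (_×-dec_; _→-dec_; decidable-stable; from-yes)
open import Relation.Unary using (Decidable)

private
  variable
    A : Set
    n q : ℕ

-- Points, lines and adjacency in the Hamming graph.

Point : ℕ → Set
Point q = Vec (Fin q) 3

-- (d , l) is the line of all points in direction d whose other two coordinates are l.
Line : ℕ → Set
Line q = Fin 3 × Vec (Fin q) 2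

Collinear : Fin (suc n) → Vec A (suc n) → Vec A (suc n) → Set
Collinear d u v = removeAt u d ≡ removeAt v d

collinear⇒lookup : ∀ {d e} {u v : Vec A (suc n)} → d ≢ e → Collinear d u v → Vec.lookup u e ≡ Vec.lookup v e
collinear⇒lookup {u = u} {v} d≢e u~v =
  trans (sym (removeAt-punchOut u d≢e))
        (trans (cong (λ w → Vec.lookup w _) u~v) (removeAt-punchOut v d≢e))

collinear⇒≡ : ∀ {d} {u v : Vec A (suc n)} → Collinear d u v → Vec.lookup u d ≡ Vec.lookup v d → u ≡ v
collinear⇒≡ {d = d} {u} {v} u~v ud≡vd =
  trans (sym (insertAt-removeAt u d)) (trans (cong₂ (λ w → insertAt w d) u~v ud≡vd) (insertAt-removeAt v d))

-- If neither `e` nor `f` were `d`, then `p` would share coordinate `d` with both `u` and `v`; these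
-- would agree there as well as elsewhere and coincide. So a clique containing two points of a line
-- stays inside that line.
clique⊆line : ∀ {d e f} {p u v : Vec A (suc n)} → u ≢ v → Collinear d u v →
              Collinear e p u → Collinear f p v → Collinear d p u
clique⊆line {d = d} {e} {f} {p} {u} {v} u≢v u~v p~u p~v with e Fin.≟ d | f Fin.≟ d
... | yes refl | _        = p~u
... | no _     | yes refl = trans p~v (sym u~v)
... | no e≢d   | no f≢d   = contradiction
  (collinear⇒≡ {u = u} u~v (trans (sym (collinear⇒lookup {u = p} {u} e≢d p~u))
                               (collinear⇒lookup {u = p} {v} f≢d p~v))) u≢v

-- Collinearity in a direction other than `d` forces agreement in coordinate `d`, the only one in
-- which `u` and `v` can differ.
direction-unique : ∀ {d e} {u v : Vec A (suc n)} → u ≢ v → Collinear d u v → Collinear e u v → d ≡ e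
direction-unique {d = d} {e} {u} {v} u≢v u~v u~′v with e Fin.≟ d
... | yes e≡d = sym e≡d
... | no e≢d  = contradiction (collinear⇒≡ {u = u} u~v (collinear⇒lookup {u = u} {v} e≢d u~′v)) u≢v

hamming≡1⇒collinear : (u v : Vec (Fin q) 3) → hammingDistance u v ≡ 1 → ∃ λ d → Collinear d u v
hamming≡1⇒collinear (a ∷ b ∷ c ∷ []) (a′ ∷ b′ ∷ c′ ∷ []) eq
  with a Fin.≟ a′ | b Fin.≟ b′ | c Fin.≟ c′
... | _        | yes refl | yes refl = 0F , refl
... | yes refl | no _     | yes refl = 1F , refl
... | yes refl | yes refl | no _     = 2F , refl
... | no _     | no _     | yes _    with () ← eq
... | no _     | yes _    | no _     with () ← eq
... | yes _    | no _     | no _     with () ← eq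
... | no _     | no _     | no _     with () ← eq

collinear⇒hamming≡1 : (d : Fin 3) (u v : Vec (Fin q) 3) → u ≢ v → Collinear d u v →
                      hammingDistance u v ≡ 1
collinear⇒hamming≡1 d (a ∷ b ∷ c ∷ []) (a′ ∷ b′ ∷ c′ ∷ []) u≢v u~v
  with a Fin.≟ a′ | b Fin.≟ b′ | c Fin.≟ c′
collinear⇒hamming≡1 d  (_ ∷ _ ∷ _ ∷ []) _ u≢v u~v  | yes refl | yes refl | yes refl = contradiction refl u≢v
collinear⇒hamming≡1 _  (_ ∷ _ ∷ _ ∷ []) _ u≢v u~v  | no _     | yes _    | yes _    = refl
collinear⇒hamming≡1 _  (_ ∷ _ ∷ _ ∷ []) _ u≢v u~v  | yes _    | no _     | yes _    = refl
collinear⇒hamming≡1 _  (_ ∷ _ ∷ _ ∷ []) _ u≢v u~v  | yes _    | yes _    | no _     = refl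
collinear⇒hamming≡1 0F (_ ∷ _ ∷ _ ∷ []) _ u≢v refl | _        | no b≢    | _        = contradiction refl b≢
collinear⇒hamming≡1 0F (_ ∷ _ ∷ _ ∷ []) _ u≢v refl | _        | _        | no c≢    = contradiction refl c≢
collinear⇒hamming≡1 1F (_ ∷ _ ∷ _ ∷ []) _ u≢v refl | no a≢    | _        | _        = contradiction refl a≢
collinear⇒hamming≡1 1F (_ ∷ _ ∷ _ ∷ []) _ u≢v refl | _        | _        | no c≢    = contradiction refl c≢
collinear⇒hamming≡1 2F (_ ∷ _ ∷ _ ∷ []) _ u≢v refl | no a≢    | _        | _        = contradiction refl a≢
collinear⇒hamming≡1 2F (_ ∷ _ ∷ _ ∷ []) _ u≢v refl | _        | no b≢    | _        = contradiction refl b≢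

-- Counting with repetition-free lists.

lookup-injective : {xs : List A} → Unique xs → ∀ {i j} → lookup xs i ≡ lookup xs j → i ≡ j
lookup-injective (x∉ ∷ u) {zero}  {zero}  _  = refl
lookup-injective (x∉ ∷ u) {zero}  {suc j} eq = contradiction eq (All.lookup x∉ (∈-lookup j))
lookup-injective (x∉ ∷ u) {suc i} {zero}  eq = contradiction (sym eq) (All.lookup x∉ (∈-lookup i))
lookup-injective (x∉ ∷ u) {suc i} {suc j} eq = cong suc (lookup-injective u eq)

-- The code of an element may depend on its membership proof, as a position given by `index` does;
-- injectivity is therefore asked for across all such proofs.
length≤-injection : {xs : List A} → Unique xs → (f : ∀ {x} → x ∈ xs → Fin n) →
                    (∀ {x y} (x∈ : x ∈ xs) (y∈ : y ∈ xs) → f x∈ ≡ f y∈ → x ≡ y) →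
                    length xs ≤ n
length≤-injection {xs = xs} u f f-inj =
  Fin.injective⇒≤ {f = λ i → f (∈-lookup {xs = xs} i)} (lookup-injective u ∘ f-inj _ _)

unique-⊆⇒length≤ : {xs ys : List A} → Unique xs → xs ⊆ ys → length xs ≤ length ys
unique-⊆⇒length≤ u xs⊆ys = length≤-injection u (index ∘ xs⊆ys)
  (λ x∈ y∈ → Setoid.index-injective (setoid _) (xs⊆ys x∈) (xs⊆ys y∈))

length-filter-¬ : {P : A → Set} (P? : Decidable P) (xs : List A) →
                  length (filter P? xs) + length (filter (¬? ∘ P?) xs) ≡ length xs
length-filter-¬ P? [] = refl
length-filter-¬ P? (x ∷ xs) with does (P? x) | length-filter-¬ P? xs
... | true  | ih = cong suc ih
... | false | ih = trans (+-suc _ _) (cong suc ih)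

-- Shadows and layers of a set of points.

shadow : Fin 3 → List (Point q) → List (Vec (Fin q) 2)
shadow d S = deduplicate (≡-dec Fin._≟_) (map (λ w → removeAt w d) S)

shadow-unique : ∀ d (S : List (Point q)) → Unique (shadow d S)
shadow-unique d S = DecUnique.deduplicate-! (≡-dec Fin._≟_) (map (λ w → removeAt w d) S)

∈-shadow⁺ : ∀ d {w} {S : List (Point q)} → w ∈ S → removeAt w d ∈ shadow d S
∈-shadow⁺ d = ∈-deduplicate⁺ (≡-dec Fin._≟_) ∘ ∈-map⁺ (λ w → removeAt w d)

∈-shadow⁻ : ∀ d {l} {S : List (Point q)} → l ∈ shadow d S → ∃ λ w → w ∈ S × l ≡ removeAt w d
∈-shadow⁻ d {S = S} = ∈-map⁻ (λ w → removeAt w d) ∘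
  ∈-deduplicate⁻ (≡-dec Fin._≟_) (map (λ w → removeAt w d) S)

shadow-mono : ∀ d {S T : List (Point q)} → S ⊆ T → shadow d S ⊆ shadow d T
shadow-mono d S⊆T l∈ with w , w∈S , refl ← ∈-shadow⁻ d l∈ = ∈-shadow⁺ d (S⊆T w∈S)

-- The projections forgetting the last and the middle coordinate together determine a point, so a
-- pair of shadow positions encodes it.
length≤shadow*shadow : {S : List (Point q)} → Unique S →
                       length S ≤ length (shadow 2F S) * length (shadow 1F S)
length≤shadow*shadow {S = S} u = length≤-injection u
  (λ w∈ → combine (index (∈-shadow⁺ 2F w∈)) (index (∈-shadow⁺ 1F w∈)))
  λ { {_ ∷ _ ∷ _ ∷ []} {_ ∷ _ ∷ _ ∷ []} v∈ w∈ eq →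
      let eq₂ , eq₁ = Fin.combine-injective (index (∈-shadow⁺ 2F v∈)) (index (∈-shadow⁺ 1F v∈))
                                            (index (∈-shadow⁺ 2F w∈)) (index (∈-shadow⁺ 1F w∈)) eq
      in joint (Setoid.index-injective (setoid _) (∈-shadow⁺ 2F v∈) (∈-shadow⁺ 2F w∈) eq₂)
               (Setoid.index-injective (setoid _) (∈-shadow⁺ 1F v∈) (∈-shadow⁺ 1F w∈) eq₁) }
  where
  joint : ∀ {v w : Point _} → removeAt v 2F ≡ removeAt w 2F → removeAt v 1F ≡ removeAt w 1F → v ≡ w
  joint {_ ∷ _ ∷ _ ∷ []} {_ ∷ _ ∷ _ ∷ []} refl refl = refl

-- The least a + b with s ≤ a * b, for s ≤ 5.
halfPerimeter : ℕ → ℕ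
halfPerimeter 0 = 0
halfPerimeter 1 = 2
halfPerimeter 2 = 3
halfPerimeter 3 = 4
halfPerimeter 4 = 4
halfPerimeter _ = 5

halfPerimeter≤5 : ∀ s → halfPerimeter s ≤ 5
halfPerimeter≤5 0 = z≤n
halfPerimeter≤5 1 = s≤s (s≤s z≤n)
halfPerimeter≤5 2 = s≤s (s≤s (s≤s z≤n))
halfPerimeter≤5 3 = n≤1+n 4
halfPerimeter≤5 4 = n≤1+n 4
halfPerimeter≤5 (suc (suc (suc (suc (suc _))))) = ≤-refl

-- If one factor is at least 5, the sum already reaches 5, the largest value of `halfPerimeter`. The
-- finitely many remaining triples are checked by computation.
halfPerimeter≤ : ∀ {s} a b → s ≤ 5 → s ≤ a * b → halfPerimeter s ≤ a + b
halfPerimeter≤ {s} a b s≤5 s≤ab with a <? 5 | b <? 5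
... | yes a<5 | yes b<5 = from-yes
  (allUpTo? (λ s → allUpTo? (λ a → allUpTo? (λ b → s ≤? a * b →-dec halfPerimeter s ≤? a + b) 5) 5) 6)
  (s≤s s≤5) a<5 b<5 s≤ab
... | no a≮5 | _ = ≤-trans (halfPerimeter≤5 s) (≤-trans (≮⇒≥ a≮5) (m≤m+n a b))
... | yes _ | no b≮5 = ≤-trans (halfPerimeter≤5 s) (≤-trans (≮⇒≥ b≮5) (m≤n+m b a))

-- The least total half-perimeter of n ≤ 5 points cut into layers of at most m points,
-- attained by filling the layers one by one; the value at m = 0 is arbitrary.
layerCost : ℕ → ℕ → ℕ
layerCost zero      n = 2 * n
layerCost m@(suc _) n = n / m * halfPerimeter m + halfPerimeter (n % m)

-- The induction step showing that no division into layers beats filling them one by one: splitting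
-- off a layer of `s` points never lowers the cost. The range is finite, so evaluation decides it.
layerCost-split : ∀ {m s n} → m < 5 → s ≤ m → s + n ≤ 5 →
                  layerCost m (s + n) ≤ halfPerimeter s + layerCost m n
layerCost-split {m} {s} {n} m<5 s≤m s+n≤5 = from-yes
  (allUpTo? (λ m → allUpTo? (λ s → allUpTo? (λ n → s ≤? m →-dec (s + n ≤? 5 →-dec
    layerCost m (s + n) ≤? halfPerimeter s + layerCost m n)) 6) 6) 5)
  m<5 (s≤s (≤-trans (m≤m+n s n) s+n≤5)) (s≤s (≤-trans (m≤n+m n s) s+n≤5)) s≤m s+n≤5

shadow-++ : ∀ d {S T U : List (Point q)} → T ⊆ S → U ⊆ S →
            (∀ {v w} → v ∈ T → w ∈ U → removeAt v d ≢ removeAt w d) →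
            length (shadow d T) + length (shadow d U) ≤ length (shadow d S)
shadow-++ d {S} {T} {U} T⊆S U⊆S disjoint = begin
  length (shadow d T) + length (shadow d U)  ≡⟨ length-++ (shadow d T) ⟨
  length (shadow d T ++ shadow d U)          ≤⟨ unique-⊆⇒length≤
    (Unique.++⁺ (shadow-unique d T) (shadow-unique d U) disj)
    (λ l∈ → [ shadow-mono d T⊆S , shadow-mono d U⊆S ]′ (∈-++⁻ (shadow d T) l∈)) ⟩
  length (shadow d S)                        ∎
  where
  open ≤-Reasoning
  disj : ∀ {l} → ¬ (l ∈ shadow d T × l ∈ shadow d U)
  disj (l∈T , l∈U) with v , v∈T , refl ← ∈-shadow⁻ d l∈T | w , w∈U , eq ← ∈-shadow⁻ d l∈U =
    disjoint v∈T w∈U eq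

-- On a layer the first coordinate is constant, so forgetting it loses nothing.
layer≤shadow : ∀ {x} {S : List (Point q)} → Unique S → (∀ {w} → w ∈ S → head w ≡ x) →
               length S ≤ length (shadow 0F S)
layer≤shadow u same = length≤-injection u (λ w∈ → index (∈-shadow⁺ 0F w∈))
  λ { {_ ∷ _} {_ ∷ _} v∈ w∈ eq → cong₂ _∷_ (trans (same v∈) (sym (same w∈)))
        (Setoid.index-injective (setoid _) (∈-shadow⁺ 0F v∈) (∈-shadow⁺ 0F w∈) eq) }

-- `k` is fuel for splitting off one layer at a time. The bound `m` passes to sublists and caps
-- every layer through `layer≤shadow`. Directions 1 and 2 keep the first coordinate, so the shadows
-- of different layers are disjoint and their sizes add up.
layerCost≤ : ∀ {m} k (S : List (Point q)) → length S ≤ k → length S ≤ 5 → Unique S →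
             length (shadow 0F S) ≤ m → m < 5 →
             layerCost m (length S) ≤ length (shadow 2F S) + length (shadow 1F S)
layerCost≤ {m = zero}  _ [] _ _ _ _ _ = z≤n
layerCost≤ {m = suc _} _ [] _ _ _ _ _ = z≤n
layerCost≤ {q} {m} (suc k) S@(p ∷ S₀) S≤k S≤5 u sh≤m m<5 = begin
  layerCost m (length S)                             ≡⟨ cong (layerCost m) T+U ⟨
  layerCost m (length T + length U)                  ≤⟨ layerCost-split m<5 T≤m
    (≤-trans (≤-reflexive T+U) S≤5) ⟩
  halfPerimeter (length T) + layerCost m (length U)  ≤⟨ +-mono-≤
    (halfPerimeter≤ (# 2F T) (# 1F T)
      (≤-trans (length-filter in-layer? S) S≤5) (length≤shadow*shadow uT))
    (layerCost≤ k U (≤-trans U≤S₀ (s≤s⁻¹ S≤k)) (≤-trans (length-filter (¬? ∘ in-layer?) S) S≤5)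
      (Unique.filter⁺ (¬? ∘ in-layer?) u)
      (≤-trans (unique-⊆⇒length≤ (shadow-unique 0F U) (shadow-mono 0F U⊆S)) sh≤m) m<5) ⟩
  (# 2F T + # 1F T) + (# 2F U + # 1F U)              ≡⟨ interchange +-commutativeSemigroup
    (# 2F T) (# 1F T) (# 2F U) (# 1F U) ⟩
  (# 2F T + # 2F U) + (# 1F T + # 1F U)              ≤⟨ +-mono-≤
    (shadow-++ 2F T⊆S U⊆S (λ {v} {w} v∈ w∈ eq → apart v∈ w∈ (heads 1F v w eq)))
    (shadow-++ 1F T⊆S U⊆S (λ {v} {w} v∈ w∈ eq → apart v∈ w∈ (heads 0F v w eq))) ⟩
  # 2F S + # 1F S                                    ∎
  where
  open ≤-Reasoning
  # : Fin 3 → List (Point q) → ℕ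
  # d = length ∘ shadow d
  in-layer? : Decidable (λ w → head w ≡ head p)
  in-layer? w = head w Fin.≟ head p
  T = filter in-layer? S
  U = filter (¬? ∘ in-layer?) S
  T⊆S : T ⊆ S
  T⊆S = proj₁ ∘ ∈-filter⁻ in-layer?
  U⊆S : U ⊆ S
  U⊆S = proj₁ ∘ ∈-filter⁻ (¬? ∘ in-layer?)
  uT = Unique.filter⁺ in-layer? u
  T+U = length-filter-¬ in-layer? S
  T≤m = ≤-trans (layer≤shadow uT (λ {w} w∈ → proj₂ (∈-filter⁻ in-layer? {xs = S} w∈)))
          (≤-trans (unique-⊆⇒length≤ (shadow-unique 0F T) (shadow-mono 0F T⊆S)) sh≤m)
  -- `p` lies in its own layer, so the filter drops it and the fuel suffices.
  U≤S₀ : length U ≤ length S₀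
  U≤S₀ = ≤-trans (≤-reflexive (cong length (filter-reject (¬? ∘ in-layer?) {p} {S₀} (λ p≢ → p≢ refl))))
                 (length-filter (¬? ∘ in-layer?) S₀)
  apart : ∀ {v w} → v ∈ T → w ∈ U → head v ≢ head w
  apart v∈ w∈ eq = proj₂ (∈-filter⁻ (¬? ∘ in-layer?) {xs = S} w∈)
    (trans (sym eq) (proj₂ (∈-filter⁻ in-layer? {xs = S} v∈)))
  heads : ∀ d (v w : Point q) → removeAt v (suc d) ≡ removeAt w (suc d) → head v ≡ head w
  heads d (_ ∷ _ ∷ _) (_ ∷ _ ∷ _) = cong head

ten≤shadows : (S : List (Point q)) → Unique S → length S ≡ 5 →
              10 ≤ length (shadow 0F S) + (length (shadow 2F S) + length (shadow 1F S))
ten≤shadows S u eq with length (shadow 0F S) <? 5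
-- For m = 0, 1, 2, 3, 4 the values of `m + layerCost m 5` are 10, 11, 10, 10, 10.
... | yes m<5 = begin
  10                                   ≤⟨ from-yes (allUpTo? (λ m → 10 ≤? m + layerCost m 5) 5) m<5 ⟩
  # 0F + layerCost (# 0F) 5            ≡⟨ cong (λ n → # 0F + layerCost (# 0F) n) eq ⟨
  # 0F + layerCost (# 0F) (length S)   ≤⟨ +-monoʳ-≤ (# 0F)
    (layerCost≤ 5 S (≤-reflexive eq) (≤-reflexive eq) u ≤-refl m<5) ⟩
  # 0F + (# 2F + # 1F)                 ∎
  where
  open ≤-Reasoning
  # : Fin 3 → ℕ
  # d = length (shadow d S)
-- The first shadow contributes 5, and the other two contribute `halfPerimeter 5`, which is 5, with
-- no division into layers.
... | no m≮5 = +-mono-≤ (≮⇒≥ m≮5)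
  (halfPerimeter≤ {5} (length (shadow 2F S)) (length (shadow 1F S)) ≤-refl
    (≤-trans (≤-reflexive (sym eq)) (length≤shadow*shadow u)))

-- Acyclic relations on finite sets.

module _ (V : FiniteSet) where
  open FiniteSet V
  open Inverse enumeration

  module _ {_⟶_ : Rel Carrier 0ℓ} (_⟶?_ : B.Decidable _⟶_) (acyclic : ∀ x → ¬ TransClosure _⟶_ x x) where

    -- The transitive closure is a strict partial order on a finite set, hence noetherian, so a walk
    -- that keeps moving to successors in `P` must stop. The order is carried over to `Fin size` for
    -- this.
    sink : {P : Carrier → Set} → Decidable P → ∃ P → ∃ λ x → P x × (∀ y → x ⟶ y → ¬ P y)
    sink {P} P? (x , Px) = descend (to x) (spo-noetherian spo (to x)) (subst P (sym (strictlyInverseʳ x)) Px)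
      where
      _⟶⁺_ : Rel (Fin size) 0ℓ
      i ⟶⁺ k = TransClosure _⟶_ (from i) (from k)
      spo : B.IsStrictPartialOrder _≡_ _⟶⁺_
      spo = record
        { isEquivalence = isEquivalence
        ; irrefl        = λ { refl → acyclic _ }
        ; trans         = transitive _⟶_
        ; <-resp-≈      = resp₂ _⟶⁺_
        }
      descend : ∀ i → Acc (λ j k → k ⟶⁺ j) i → P (from i) → ∃ λ x → P x × (∀ y → x ⟶ y → ¬ P y)
      descend i (acc rs) Pi with any? (λ y → (from i ⟶? y) ×-dec P? y)
      ... | no none            = from i , Pi , λ y i⟶y Py → none (y , i⟶y , Py)
      ... | yes (y , i⟶y , Py) =
        descend (to y) (rs (subst (TransClosure _⟶_ (from i)) y≡ [ i⟶y ])) (subst P y≡ Py)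
        where
        y≡ : y ≡ from (to y)
        y≡ = sym (strictlyInverseʳ y)

    open DecMembership _≟_ using (_∈?_)

    Closed : List Carrier → Set
    Closed R = ∀ {u v} → u ∈ R → u ⟶ v → v ∈ R

    -- Take a sink among the vertices outside `R`. Were there none outside, positions in `R` would
    -- inject all `size` vertices into fewer places.
    extend : ∀ R → length R < size → ∃ λ w → w ∉ R × (∀ v → w ⟶ v → v ∈ R)
    extend R R<V with any? (λ v → ¬? (v ∈? R))
    ... | yes outside =
      let w , w∉R , out = sink (λ v → ¬? (v ∈? R)) outside
      in w , w∉R , λ v w⟶v → decidable-stable (v ∈? R) (out v w⟶v)
    ... | no none = contradiction (Fin.injective⇒≤ {f = λ i → index (all-in (from i))}
        (λ {i} {k} eq → from-injective (Setoid.index-injective (setoid _) (all-in (from i)) (all-in (from k)) eq)))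
        (<⇒≱ R<V)
      where
      all-in : ∀ v → v ∈ R
      all-in v = decidable-stable (v ∈? R) (λ v∉R → none (v , v∉R))
      from-injective : ∀ {i k} → from i ≡ from k → i ≡ k
      from-injective {i} {k} eq = trans (sym (strictlyInverseˡ i)) (trans (cong to eq) (strictlyInverseˡ k))

    closed-list : ∀ m → m ≤ size → ∃ λ R → length R ≡ m × Unique R × Closed R
    closed-list zero    _   = [] , refl , [] , λ ()
    closed-list (suc m) m<V
      with R , refl , u , closed ← closed-list m (<⇒≤ m<V)
      with w , w∉R , out ← extend R m<V
      = w ∷ R , refl , ¬Any⇒All¬ R w∉R ∷ u ,
        λ { (here refl) w⟶v → there (out _ w⟶v) ; (there u∈R) u⟶v → there (closed u∈R u⟶v) }

-- The lines meeting a set of points.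

linesAlong : Fin 3 → List (Point q) → List (Line q)
linesAlong d S = map (d ,_) (shadow d S)

-- The directions come in the order 0, 2, 1 to match the sum in `ten≤shadows`.
lines : List (Point q) → List (Line q)
lines S = linesAlong 0F S ++ linesAlong 2F S ++ linesAlong 1F S

∈-linesAlong⁻ : ∀ d {l} (S : List (Point q)) → l ∈ linesAlong d S → ∃ λ w → w ∈ S × l ≡ (d , removeAt w d)
∈-linesAlong⁻ d S l∈ with _ , l∈′ , refl ← ∈-map⁻ (d ,_) l∈ with w , w∈S , refl ← ∈-shadow⁻ d l∈′ =
  w , w∈S , refl

∈-lines⁻ : ∀ {l} (S : List (Point q)) → l ∈ lines S → ∃₂ λ d w → w ∈ S × l ≡ (d , removeAt w d)
∈-lines⁻ S l∈ with ∈-++⁻ (linesAlong 0F S) l∈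
... | inj₁ l∈₀ = 0F , ∈-linesAlong⁻ 0F S l∈₀
... | inj₂ l∈₂₁ with ∈-++⁻ (linesAlong 2F S) l∈₂₁
...   | inj₁ l∈₂ = 2F , ∈-linesAlong⁻ 2F S l∈₂
...   | inj₂ l∈₁ = 1F , ∈-linesAlong⁻ 1F S l∈₁

lines-unique : (S : List (Point q)) → Unique (lines S)
lines-unique S = Unique.++⁺ (uniq 0F) (Unique.++⁺ (uniq 2F) (uniq 1F) (disjoint λ ()))
  λ (l∈₀ , l∈) → [ (λ l∈₂ → disjoint (λ ()) (l∈₀ , l∈₂)) , (λ l∈₁ → disjoint (λ ()) (l∈₀ , l∈₁)) ]′
    (∈-++⁻ (linesAlong 2F S) l∈)
  where
  uniq : ∀ d → Unique (linesAlong d S)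
  uniq d = Unique.map⁺ (λ { refl → refl }) (shadow-unique d S)
  disjoint : ∀ {d e} → d ≢ e → ∀ {l} → ¬ (l ∈ linesAlong d S × l ∈ linesAlong e S)
  disjoint {d} {e} d≢e (l∈d , l∈e)
    with _ , _ , refl ← ∈-linesAlong⁻ d S l∈d | _ , _ , eq ← ∈-linesAlong⁻ e S l∈e = d≢e (cong proj₁ eq)

length-lines : (S : List (Point q)) →
  length (lines S) ≡ length (shadow 0F S) + (length (shadow 2F S) + length (shadow 1F S))
length-lines S = trans (length-++ (linesAlong 0F S))
  (cong₂ _+_ (length-map _ (shadow 0F S))
    (trans (length-++ (linesAlong 2F S))
           (cong₂ _+_ (length-map _ (shadow 2F S)) (length-map _ (shadow 1F S)))))

line-neighbour : ∀ d (w : Point (2 + q)) → ∃ λ u → u ≢ w × Collinear d u w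
line-neighbour d w = insertAt (removeAt w d) d a , u≢w , removeAt-insertAt (removeAt w d) d a
  where
  another : ∀ {n} (a : Fin (2 + n)) → ∃ λ b → b ≢ a
  another zero    = 1F , λ ()
  another (suc _) = 0F , λ ()
  a = proj₁ (another (Vec.lookup w d))
  u≢w : insertAt (removeAt w d) d a ≢ w
  u≢w u≡w = proj₂ (another (Vec.lookup w d))
    (trans (sym (insertAt-lookup (removeAt w d) d a)) (cong (λ v → Vec.lookup v d) u≡w))

-- Lower bound: lines are told apart by their preys.

module _ {q j : ℕ} (D : Digraph (tuples 3 (2 + q) ⊎ᶠ finSet j)) (acyclic : Acyclic D)
         (D≈H : competitionGraph D ≈ (H 3 (2 + q) ∪I j)) where

  open Digraph D
  V = tuples 3 (2 + q)
  open FiniteSet V using (_≟_)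

  _⟶_ : Rel (Point (2 + q)) 0ℓ
  u ⟶ v = Arc (inj₁ u) (inj₁ v)

  ⟶-acyclic : ∀ x → ¬ TransClosure _⟶_ x x
  ⟶-acyclic x = acyclic (inj₁ x) ∘ embed
    where
    embed : ∀ {u v} → TransClosure _⟶_ u v → TransClosure Arc (inj₁ u) (inj₁ v)
    embed [ u⟶v ]       = [ u⟶v ]
    embed (u⟶v ∷ v⟶⁺w) = u⟶v ∷ embed v⟶⁺w

  -- A prey attached to the line through `w` in direction `d`. The second predator on that line is
  -- what pins the line down.
  record SharedPrey (d : Fin 3) (w : Point (2 + q)) : Set where
    field
      prey      : Point (2 + q) ⊎ Fin j
      partner   : Point (2 + q)
      distinct  : w ≢ partner
      collinear : Collinear d w partner
      hunts     : Arc (inj₁ w) prey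
      hunts′    : Arc (inj₁ partner) prey

  sharedPrey : ∀ d w → SharedPrey d w
  sharedPrey d w
    with u , u≢w , u~w ← line-neighbour d w
    with _ , x , u→x , w→x ← Equivalence.from (D≈H (inj₁ u) (inj₁ w)) (Sum.inj₁ (collinear⇒hamming≡1 d u w u≢w u~w))
    = record { prey = x ; partner = u ; distinct = ≢-sym u≢w ; collinear = sym u~w ; hunts = w→x ; hunts′ = u→x }

  predators-collinear : ∀ {u v x} → Arc (inj₁ u) x → Arc (inj₁ v) x → ∃ λ d → Collinear d u v
  predators-collinear {u} {v} u→x v→x with u ≟ v
  -- A point is collinear with itself in every direction; `0F` is an arbitrary choice.
  ... | yes refl = 0F , refl
  ... | no u≢v with Equivalence.to (D≈H (inj₁ u) (inj₁ v)) ((λ { refl → u≢v refl }) , _ , u→x , v→x)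
  ...   | Sum.inj₁ d≡1 = hamming≡1⇒collinear u v d≡1

  -- Predators of one prey are pairwise collinear, so by `clique⊆line` they all lie on the line of
  -- `s`. This includes `w` and the partner in `t`, two distinct points that lie on the line of `t`
  -- as well, so the two lines coincide.
  prey-determines-line : ∀ {d e v w} (s : SharedPrey d v) (t : SharedPrey e w) →
    SharedPrey.prey s ≡ SharedPrey.prey t → _≡_ {A = Line (2 + q)} (d , removeAt v d) (e , removeAt w e)
  prey-determines-line {d} {e} {v} {w} s t refl = lemma (direction-unique T.distinct w~partner T.collinear)
    where
    module S = SharedPrey s
    module T = SharedPrey t
    onto : ∀ {p} → Arc (inj₁ p) S.prey → Collinear d p v
    onto {p} p→x = clique⊆line {p = p} S.distinct S.collinear
      (proj₂ (predators-collinear p→x S.hunts)) (proj₂ (predators-collinear p→x S.hunts′))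
    w~partner : Collinear d w T.partner
    w~partner = trans (onto T.hunts) (sym (onto T.hunts′))
    lemma : d ≡ e → (d , removeAt v d) ≡ (e , removeAt w e)
    lemma refl = cong (d ,_) (sym (onto T.hunts))

  -- Counting the preys of a set whose hunted points lie in a given list.

  module _ (S R : List (Point (2 + q))) (preys⊆R : ∀ {u v} → u ∈ S → u ⟶ v → v ∈ R) where

    Prey : Point (2 + q) ⊎ Fin j → Set
    Prey x = ∃ λ u → u ∈ S × Arc (inj₁ u) x

    -- A prey of `S` is an extra vertex, coded by its own index, or a point of `R`, coded by its
    -- position there.
    code : ∀ x → Prey x → Fin (j + length R)
    code (inj₁ v) (_ , u∈S , u⟶v) = join j _ (inj₂ (index (preys⊆R u∈S u⟶v)))
    code (inj₂ i) _               = join j _ (inj₁ i)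

    join-injective : ∀ {a b} → join j (length R) a ≡ join j (length R) b → a ≡ b
    join-injective {a} {b} eq = trans (sym (Fin.splitAt-join j _ a))
      (trans (cong (splitAt j) eq) (Fin.splitAt-join j _ b))

    code-injective : ∀ x y (p : Prey x) (r : Prey y) → code x p ≡ code y r → x ≡ y
    code-injective (inj₁ _) (inj₁ _) (_ , u∈S , u⟶v) (_ , u∈S′ , u⟶v′) eq =
      cong inj₁ (Setoid.index-injective (setoid _) (preys⊆R u∈S u⟶v) (preys⊆R u∈S′ u⟶v′)
        (inj₂-injective (join-injective eq)))
    code-injective (inj₁ _) (inj₂ _) _ _ eq with () ← join-injective {inj₂ _} {inj₁ _} eq
    code-injective (inj₂ _) (inj₁ _) _ _ eq with () ← join-injective {inj₁ _} {inj₂ _} eq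
    code-injective (inj₂ _) (inj₂ _) _ _ eq = cong inj₂ (inj₁-injective (join-injective eq))

    preyOf : ∀ {l} → l ∈ lines S → Point (2 + q) ⊎ Fin j
    preyOf l∈ = let d , u , _ = ∈-lines⁻ S l∈ in SharedPrey.prey (sharedPrey d u)

    preyOf-prey : ∀ {l} (l∈ : l ∈ lines S) → Prey (preyOf l∈)
    preyOf-prey l∈ = let d , u , u∈S , _ = ∈-lines⁻ S l∈ in u , u∈S , SharedPrey.hunts (sharedPrey d u)

    place : ∀ {l} → l ∈ lines S → Fin (j + length R)
    place l∈ = code (preyOf l∈) (preyOf-prey l∈)

    place-injective : ∀ {l m} (l∈ : l ∈ lines S) (m∈ : m ∈ lines S) → place l∈ ≡ place m∈ → l ≡ m
    place-injective l∈ m∈ eq =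
      let d , u , _ , l≡ = ∈-lines⁻ S l∈
          e , v , _ , m≡ = ∈-lines⁻ S m∈
      in trans l≡ (trans (prey-determines-line (sharedPrey d u) (sharedPrey e v)
           (code-injective _ _ (preyOf-prey l∈) (preyOf-prey m∈) eq)) (sym m≡))

    lines≤preys : length (lines S) ≤ j + length R
    lines≤preys = length≤-injection (lines-unique S) place place-injective

  _⟶?_ : B.Decidable _⟶_
  u ⟶? v = arc? (inj₁ u) (inj₁ v)

  -- Compare with 8 = 2 ^ 3.
  5≤size : 5 ≤ (2 + q) ^ 3
  5≤size = ≤-trans (m≤m+n 5 3) (^-monoˡ-≤ 3 (m≤m+n 2 q))

  closed⇒6≤ : (∃ λ R → length R ≡ 4 × Unique R × Closed V _⟶?_ ⟶-acyclic R) → 6 ≤ j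
  closed⇒6≤ (R , R≡4 , uR , closed) = conclude
    (extend V _⟶?_ ⟶-acyclic R (subst (_< (2 + q) ^ 3) (sym R≡4) 5≤size))
    where
    open ≤-Reasoning
    conclude : (∃ λ w → w ∉ R × (∀ v → w ⟶ v → v ∈ R)) → 6 ≤ j
    -- The fifth point `w` counts as a predator but adds no prey: `w` hunts only into `R`, and `R`
    -- is closed.
    conclude (w , w∉R , out) = +-cancelʳ-≤ 4 6 j (begin
      10                       ≤⟨ ten≤shadows (w ∷ R) (¬Any⇒All¬ R w∉R ∷ uR) (cong suc R≡4) ⟩
      _                        ≡⟨ length-lines (w ∷ R) ⟨
      length (lines (w ∷ R))   ≤⟨ lines≤preys (w ∷ R) R
        (λ { (here refl) → out _ ; (there u∈R) → closed u∈R }) ⟩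
      j + length R             ≡⟨ cong (j +_) R≡4 ⟩
      j + 4                    ∎)

  lower-bound : 6 ≤ j
  lower-bound = closed⇒6≤ (closed-list V _⟶?_ ⟶-acyclic 4 (<⇒≤ 5≤size))

-- Upper bound: a private prey for every line.

successor : ∀ {n} → Fin n → Maybe (Fin n)
successor i with view i
... | ‵fromℕ     = nothing
... | ‵inject₁ j = just (suc j)

successor-fromℕ : ∀ n → successor (fromℕ n) ≡ nothing
successor-fromℕ n rewrite view-fromℕ n = refl

-- `prey` steps back with `inject₁`, and `successor` undoes the step. Its failure at the top element
-- lets `owner` recognise preys placed at the end of a row.
successor-inject₁ : ∀ {n} (i : Fin n) → successor (inject₁ i) ≡ just (suc i)
successor-inject₁ i rewrite view-inject₁ i = refl

module Construction (r : ℕ) where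

  top : Fin (3 + r)
  top = fromℕ (2 + r)

  -- A line is given as (0F , y ∷ z), (1F , x ∷ z) or (2F , x ∷ y); the clauses of
  -- each direction distinguish the kinds of slab in which the line is first met.
  prey : Line (3 + r) → Point (3 + r) ⊎ Fin 6
  prey (0F , 0F ∷ 0F ∷ [])                       = inj₂ 0F
  prey (0F , 1F ∷ 0F ∷ [])                       = inj₂ 1F
  prey (0F , suc (suc y) ∷ 0F ∷ [])              = inj₁ (top ∷ inject₁ (suc y) ∷ 0F ∷ [])
  prey (0F , 0F ∷ 1F ∷ [])                       = inj₂ 2F
  prey (0F , 1F ∷ 1F ∷ [])                       = inj₂ 3F
  prey (0F , y@(suc (suc _)) ∷ 1F ∷ [])          = inj₁ (0F ∷ y ∷ 0F ∷ [])
  prey (0F , 0F ∷ suc (suc z) ∷ [])              = inj₁ (top ∷ top ∷ inject₁ (suc z) ∷ [])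
  prey (0F , suc y ∷ z@(suc (suc _)) ∷ [])       = inj₁ (top ∷ inject₁ y ∷ z ∷ [])
  prey (1F , x ∷ 1F ∷ [])                        = inj₁ (x ∷ 0F ∷ 0F ∷ [])
  prey (1F , 0F ∷ 0F ∷ [])                       = inj₂ 4F
  prey (1F , suc x ∷ 0F ∷ [])                    = inj₁ (inject₁ x ∷ 1F ∷ 0F ∷ [])
  prey (1F , 0F ∷ suc (suc z) ∷ [])              = inj₁ (1F ∷ top ∷ inject₁ (suc z) ∷ [])
  prey (1F , suc x ∷ z@(suc (suc _)) ∷ [])       = inj₁ (inject₁ x ∷ 0F ∷ z ∷ [])
  prey (2F , x ∷ 1F ∷ [])                        = inj₁ (x ∷ 0F ∷ 1F ∷ [])
  prey (2F , 0F ∷ 0F ∷ [])                       = inj₂ 5F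
  prey (2F , suc x ∷ 0F ∷ [])                    = inj₁ (inject₁ x ∷ 1F ∷ 1F ∷ [])
  prey (2F , 0F ∷ suc (suc y) ∷ [])              = inj₁ (top ∷ inject₁ (suc y) ∷ 1F ∷ [])
  prey (2F , 1F ∷ y@(suc (suc _)) ∷ [])          = inj₁ (0F ∷ y ∷ 1F ∷ [])
  prey (2F , suc (suc x) ∷ y@(suc (suc _)) ∷ []) = inj₁ (inject₁ (suc x) ∷ y ∷ 0F ∷ [])

  -- A placeholder for owner at vertices in the image of no line.
  junk : Line (3 + r)
  junk = 0F , 0F ∷ 0F ∷ []

  -- A left inverse of `prey`. It yields injectivity from one case analysis, without comparing the
  -- clauses of `prey` in pairs.
  owner : Point (3 + r) ⊎ Fin 6 → Line (3 + r)
  owner (inj₁ (x ∷ 0F ∷ z@(suc (suc _)) ∷ [])) =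
    maybe′ (λ x⁺ → 1F , x⁺ ∷ z ∷ []) (0F , 1F ∷ z ∷ []) (successor x)
  owner (inj₁ (x ∷ y@(suc _) ∷ z@(suc (suc _)) ∷ [])) =
    maybe′ (λ _ → maybe′ (λ z⁺ → 1F , 0F ∷ z⁺ ∷ []) junk (successor z))
           (maybe′ (λ y⁺ → 0F , y⁺ ∷ z ∷ [])
                   (maybe′ (λ z⁺ → 0F , 0F ∷ z⁺ ∷ []) junk (successor z)) (successor y))
           (successor x)
  owner (inj₂ 0F) = 0F , 0F ∷ 0F ∷ []
  owner (inj₂ 1F) = 0F , 1F ∷ 0F ∷ []
  owner (inj₂ 2F) = 0F , 0F ∷ 1F ∷ []
  owner (inj₂ 3F) = 0F , 1F ∷ 1F ∷ []
  owner (inj₂ 4F) = 1F , 0F ∷ 0F ∷ []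
  owner (inj₂ 5F) = 2F , 0F ∷ 0F ∷ []
  owner (inj₁ (x ∷ 0F ∷ 0F ∷ [])) = 1F , x ∷ 1F ∷ []
  owner (inj₁ (x ∷ 1F ∷ 0F ∷ [])) =
    maybe′ (λ x⁺ → 1F , x⁺ ∷ 0F ∷ []) (0F , 2F ∷ 0F ∷ []) (successor x)
  owner (inj₁ (0F ∷ y@(suc (suc _)) ∷ 0F ∷ [])) = 0F , y ∷ 1F ∷ []
  owner (inj₁ (x@(suc _) ∷ y@(suc (suc _)) ∷ 0F ∷ [])) =
    maybe′ (λ x⁺ → 2F , x⁺ ∷ y ∷ [])
           (maybe′ (λ y⁺ → 0F , y⁺ ∷ 0F ∷ []) junk (successor y)) (successor x)
  owner (inj₁ (x ∷ 0F ∷ 1F ∷ [])) = 2F , x ∷ 1F ∷ []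
  owner (inj₁ (x ∷ 1F ∷ 1F ∷ [])) =
    maybe′ (λ x⁺ → 2F , x⁺ ∷ 0F ∷ []) (2F , 0F ∷ 2F ∷ []) (successor x)
  owner (inj₁ (0F ∷ y@(suc (suc _)) ∷ 1F ∷ [])) = 2F , 1F ∷ y ∷ []
  owner (inj₁ (x@(suc _) ∷ y@(suc (suc _)) ∷ 1F ∷ [])) =
    maybe′ (λ _ → 1F , 0F ∷ 2F ∷ [])
           (maybe′ (λ y⁺ → 2F , 0F ∷ y⁺ ∷ []) (0F , 0F ∷ 2F ∷ []) (successor y)) (successor x)

  owner∘prey : ∀ l → owner (prey l) ≡ l
  owner∘prey (0F , 0F ∷ 0F ∷ []) = refl
  owner∘prey (0F , 1F ∷ 0F ∷ []) = refl
  -- Index 2 is split off wherever the prey uses its predecessor 1, which falls under a different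
  -- clause of `owner` than larger values.
  owner∘prey (0F , 2F ∷ 0F ∷ []) rewrite successor-fromℕ (2 + r) = refl
  owner∘prey (0F , suc (suc (suc y)) ∷ 0F ∷ [])
    rewrite successor-fromℕ (2 + r) | successor-inject₁ (suc (suc y)) = refl
  owner∘prey (0F , 0F ∷ 1F ∷ []) = refl
  owner∘prey (0F , 1F ∷ 1F ∷ []) = refl
  owner∘prey (0F , suc (suc y) ∷ 1F ∷ []) = refl
  owner∘prey (0F , 0F ∷ 2F ∷ []) rewrite successor-fromℕ (2 + r) = refl
  owner∘prey (0F , 0F ∷ suc (suc (suc z)) ∷ [])
    rewrite successor-fromℕ (2 + r) | successor-inject₁ (suc (suc z)) = refl
  owner∘prey (0F , 1F ∷ suc (suc z) ∷ []) rewrite successor-fromℕ (2 + r) = refl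
  owner∘prey (0F , suc (suc y) ∷ suc (suc z) ∷ [])
    rewrite successor-fromℕ (2 + r) | successor-inject₁ (suc y) = refl
  owner∘prey (1F , 0F ∷ 0F ∷ []) = refl
  owner∘prey (1F , suc x ∷ 0F ∷ []) rewrite successor-inject₁ x = refl
  owner∘prey (1F , x ∷ 1F ∷ []) = refl
  owner∘prey (1F , 0F ∷ 2F ∷ []) = refl
  owner∘prey (1F , 0F ∷ suc (suc (suc z)) ∷ []) rewrite successor-inject₁ (suc (suc z)) = refl
  owner∘prey (1F , suc x ∷ suc (suc z) ∷ []) rewrite successor-inject₁ x = refl
  owner∘prey (2F , 0F ∷ 0F ∷ []) = refl
  owner∘prey (2F , suc x ∷ 0F ∷ []) rewrite successor-inject₁ x = refl
  owner∘prey (2F , x ∷ 1F ∷ []) = refl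
  owner∘prey (2F , 0F ∷ 2F ∷ []) rewrite successor-fromℕ (2 + r) = refl
  owner∘prey (2F , 0F ∷ suc (suc (suc y)) ∷ [])
    rewrite successor-fromℕ (2 + r) | successor-inject₁ (suc (suc y)) = refl
  owner∘prey (2F , 1F ∷ suc (suc y) ∷ []) = refl
  owner∘prey (2F , suc (suc x) ∷ suc (suc y) ∷ []) rewrite successor-inject₁ (suc x) = refl

  -- Compared lexicographically, keys list the vertices in the order in which the box grows.
  key : Point (3 + r) ⊎ Fin 6 → Vec ℕ 4
  key (inj₂ _) = 0 ∷ 0 ∷ 0 ∷ 0 ∷ []
  key (inj₁ (x ∷ y ∷ z@(suc (suc _)) ∷ [])) = toℕ z ∷ toℕ y ∷ toℕ x ∷ 0 ∷ []
  key (inj₁ (x ∷ y@(suc (suc _)) ∷ z ∷ [])) = 1 ∷ toℕ y ∷ toℕ x ∷ toℕ z ∷ []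
  key (inj₁ (x ∷ y ∷ z ∷ []))              = 1 ∷ 0 ∷ toℕ x ∷ 2 * toℕ y + toℕ z ∷ []

  infix 4 _≺_
  _≺_ : ∀ {n} → Vec ℕ n → Vec ℕ n → Set
  _≺_ = Lex-< _≡_ _<_

  inject₁-< : ∀ {n} (i : Fin n) → toℕ (inject₁ i) < suc (toℕ i)
  inject₁-< i = s≤s (≤-reflexive (Fin.toℕ-inject₁ i))

  -- The prey was placed before the first point of the line, hence before `u`. It is an extra
  -- vertex, lies in an earlier slab, or comes earlier in the same slab; the number of `next` steps
  -- tells how many key entries agree.
  prey-decreases : ∀ d u → key (prey (d , removeAt u d)) ≺ key (inj₁ u)
  prey-decreases 0F (x ∷ 0F ∷ 0F ∷ []) = this z<s refl
  prey-decreases 0F (x ∷ 1F ∷ 0F ∷ []) = this z<s refl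
  prey-decreases 0F (x ∷ 2F ∷ 0F ∷ []) = next refl (this z<s refl)
  prey-decreases 0F (x ∷ suc (suc (suc y)) ∷ 0F ∷ []) = next refl (this (inject₁-< (suc (suc y))) refl)
  prey-decreases 0F (x ∷ 0F ∷ 1F ∷ []) = this z<s refl
  prey-decreases 0F (x ∷ 1F ∷ 1F ∷ []) = this z<s refl
  prey-decreases 0F (0F ∷ suc (suc y) ∷ 1F ∷ []) = next refl (next refl (next refl (this z<s refl)))
  prey-decreases 0F (suc x ∷ suc (suc y) ∷ 1F ∷ []) = next refl (next refl (this z<s refl))
  prey-decreases 0F (x ∷ 0F ∷ 2F ∷ []) = this (s<s z<s) refl
  prey-decreases 0F (x ∷ 0F ∷ suc (suc (suc z)) ∷ []) = this (inject₁-< (suc (suc z))) refl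
  prey-decreases 0F (x ∷ 1F ∷ suc (suc z) ∷ []) = next refl (this z<s refl)
  prey-decreases 0F (x ∷ suc (suc y) ∷ suc (suc z) ∷ []) = next refl (this (inject₁-< (suc y)) refl)
  prey-decreases 1F (0F ∷ 0F ∷ 0F ∷ []) = this z<s refl
  prey-decreases 1F (0F ∷ 1F ∷ 0F ∷ []) = this z<s refl
  prey-decreases 1F (0F ∷ suc (suc y) ∷ 0F ∷ []) = this z<s refl
  prey-decreases 1F (suc x ∷ 0F ∷ 0F ∷ []) = next refl (next refl (this (inject₁-< x) refl))
  prey-decreases 1F (suc x ∷ 1F ∷ 0F ∷ []) = next refl (next refl (this (inject₁-< x) refl))
  prey-decreases 1F (suc x ∷ suc (suc y) ∷ 0F ∷ []) = next refl (this z<s refl)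
  prey-decreases 1F (x ∷ 0F ∷ 1F ∷ []) = next refl (next refl (next refl (this z<s refl)))
  prey-decreases 1F (x ∷ 1F ∷ 1F ∷ []) = next refl (next refl (next refl (this z<s refl)))
  prey-decreases 1F (x ∷ suc (suc y) ∷ 1F ∷ []) = next refl (this z<s refl)
  prey-decreases 1F (0F ∷ y ∷ 2F ∷ []) = this (s<s z<s) refl
  prey-decreases 1F (0F ∷ y ∷ suc (suc (suc z)) ∷ []) = this (inject₁-< (suc (suc z))) refl
  prey-decreases 1F (suc x ∷ 0F ∷ suc (suc z) ∷ []) = next refl (next refl (this (inject₁-< x) refl))
  prey-decreases 1F (suc x ∷ suc y ∷ suc (suc z) ∷ []) = next refl (this z<s refl)
  prey-decreases 2F (0F ∷ 0F ∷ 0F ∷ []) = this z<s refl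
  prey-decreases 2F (0F ∷ 0F ∷ 1F ∷ []) = this z<s refl
  prey-decreases 2F (0F ∷ 0F ∷ suc (suc z) ∷ []) = this z<s refl
  prey-decreases 2F (suc x ∷ 0F ∷ 0F ∷ []) = next refl (next refl (this (inject₁-< x) refl))
  prey-decreases 2F (suc x ∷ 0F ∷ 1F ∷ []) = next refl (next refl (this (inject₁-< x) refl))
  prey-decreases 2F (suc x ∷ 0F ∷ suc (suc z) ∷ []) = this (s<s z<s) refl
  prey-decreases 2F (x ∷ 1F ∷ 0F ∷ []) = next refl (next refl (next refl (this (s<s z<s) refl)))
  prey-decreases 2F (x ∷ 1F ∷ 1F ∷ []) = next refl (next refl (next refl (this (s<s z<s) refl)))
  prey-decreases 2F (x ∷ 1F ∷ suc (suc z) ∷ []) = this (s<s z<s) refl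
  prey-decreases 2F (0F ∷ 2F ∷ 0F ∷ []) = next refl (this z<s refl)
  prey-decreases 2F (0F ∷ suc (suc (suc y)) ∷ 0F ∷ []) = next refl (this (inject₁-< (suc (suc y))) refl)
  prey-decreases 2F (1F ∷ suc (suc y) ∷ 0F ∷ []) = next refl (next refl (this z<s refl))
  prey-decreases 2F (suc (suc x) ∷ suc (suc y) ∷ 0F ∷ []) = next refl (next refl (this (inject₁-< (suc x)) refl))
  prey-decreases 2F (0F ∷ 2F ∷ 1F ∷ []) = next refl (this z<s refl)
  prey-decreases 2F (0F ∷ suc (suc (suc y)) ∷ 1F ∷ []) = next refl (this (inject₁-< (suc (suc y))) refl)
  prey-decreases 2F (1F ∷ suc (suc y) ∷ 1F ∷ []) = next refl (next refl (this z<s refl))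
  prey-decreases 2F (suc (suc x) ∷ suc (suc y) ∷ 1F ∷ []) = next refl (next refl (this (inject₁-< (suc x)) refl))
  prey-decreases 2F (0F ∷ 2F ∷ suc (suc z) ∷ []) = this (s<s z<s) refl
  prey-decreases 2F (0F ∷ suc (suc (suc y)) ∷ suc (suc z) ∷ []) = this (s<s z<s) refl
  prey-decreases 2F (1F ∷ suc (suc y) ∷ suc (suc z) ∷ []) = this (s<s z<s) refl
  prey-decreases 2F (suc (suc x) ∷ suc (suc y) ∷ suc (suc z) ∷ []) = this (s<s z<s) refl

  -- The digraph, its acyclicity and its competition graph.

  module ≺ = B.IsStrictPartialOrder (Lex.<-isStrictPartialOrder <-isStrictPartialOrder {4})

  Vertex : Set
  Vertex = Point (3 + r) ⊎ Fin 6

  Arc : Rel Vertex 0ℓ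
  Arc (inj₁ u) x = ∃ λ d → prey (d , removeAt u d) ≡ x
  Arc (inj₂ _) x = ⊥

  digraph : Digraph (tuples 3 (3 + r) ⊎ᶠ finSet 6)
  digraph = record
    { Arc  = Arc
    ; arc? = λ { (inj₁ u) x → Fin.any? λ d → ⊎-≡-dec (≡-dec Fin._≟_) Fin._≟_ (prey (d , removeAt u d)) x
               ; (inj₂ _) x → no λ () }
    }

  arc-decreases : ∀ u {x} → Arc u x → key x ≺ key u
  arc-decreases (inj₁ u) (d , refl) = prey-decreases d u

  digraph-acyclic : Acyclic digraph
  digraph-acyclic x cycle = ≺.irrefl ≺.Eq.refl (descend cycle)
    where
    descend : ∀ {u v} → TransClosure Arc u v → key v ≺ key u
    descend {u} [ u→v ]        = arc-decreases u u→v
    descend {u} (u→v ∷ v→⁺w) = ≺.trans (descend v→⁺w) (arc-decreases u u→v)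

  -- A point hunts the preys of its three lines, and `owner` recovers the line from the prey. Hence
  -- the predators of a line's prey are exactly the points of that line, and sharing a prey means
  -- sharing a line.
  digraph≈H : competitionGraph digraph ≈ (H 3 (3 + r) ∪I 6)
  digraph≈H (inj₁ u) (inj₁ v) = mk⇔ to from
    where
    to : Graph.Adj (competitionGraph digraph) (inj₁ u) (inj₁ v) →
         Graph.Adj (H 3 (3 + r) ∪I 6) (inj₁ u) (inj₁ v)
    to (u≢v , x , (d , du→x) , (e , ev→x)) = Sum.inj₁ (adjacent same-line)
      where
      same-line : _≡_ {A = Line (3 + r)} (d , removeAt u d) (e , removeAt v e)
      same-line = trans (sym (owner∘prey _)) (trans (cong owner (trans du→x (sym ev→x))) (owner∘prey _))
      adjacent : _≡_ {A = Line (3 + r)} (d , removeAt u d) (e , removeAt v e) → hammingDistance u v ≡ 1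
      adjacent eq with refl ← cong proj₁ eq =
        collinear⇒hamming≡1 d u v (u≢v ∘ cong inj₁) (cong proj₂ eq)
    from : Graph.Adj (H 3 (3 + r) ∪I 6) (inj₁ u) (inj₁ v) →
           Graph.Adj (competitionGraph digraph) (inj₁ u) (inj₁ v)
    from (Sum.inj₁ uv) with d , u~v ← hamming≡1⇒collinear u v uv =
      (λ { refl → Graph.irrefl (H 3 (3 + r)) {u} refl uv }) ,
      prey (d , removeAt u d) , (d , refl) , (d , cong (λ l → prey (d , l)) (sym u~v))
  digraph≈H (inj₁ _) (inj₂ _) = mk⇔ (λ { (_ , _ , _ , ()) }) λ ()
  digraph≈H (inj₂ _) (inj₁ _) = mk⇔ (λ { (_ , _ , () , _) }) λ ()
  digraph≈H (inj₂ _) (inj₂ _) = mk⇔ (λ { (_ , _ , () , _) }) λ { (Sum.inj₂ ()) }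

theorem5 : (q : ℕ) → 3 ≤ q → IsCompetitionNumber (H 3 q) 6
theorem5 (suc (suc (suc r))) (s≤s (s≤s (s≤s _))) =
  (digraph , digraph-acyclic , digraph≈H) ,
  λ j (D , acyclic , D≈H) → lower-bound D acyclic D≈H
  where open Construction r
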